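{- Let $G=(V,E)$ be an $n$-vertex undirected unweighted graph, let $H^*$ be a $(\beta,\epsilon)$-hopset for $G$, and let $G^*$ be a $t$-multiplicative spanner for $G$. Then $H^*\cup G^*$ is a $(1+\epsilon,\beta\cdot t)$-emulator for $G$.
   Context: Here $\beta\geq 1$ is an integer and $\epsilon\in(0,1)$. $\mathrm{dist}^{(\beta)}_{G'}(u,v)$ is the minimum length of a $u$-$v$ path in $G'$ with at most $\beta$ edges. A $(\beta,\epsilon)$-hopset for $G$ is a set $H\subseteq V\times V$ of weighted edges (each weighted by the shortest-path distance in $G$ between its endpoints) such that $\mathrm{dist}_G(u,v)\le \mathrm{dist}^{(\beta)}_{G\cup H}(u,v)\le(1+\epsilon)\mathrm{dist}_G(u,v)$ for all $u,v\in V$. A $t$-multiplicative spanner of $G$ is a subgraph $G^*\subseteq G$ with $\mathrm{dist}_{G^*}(u,v)\le t\cdot\mathrm{dist}_G(u,v)$ for all $u,v\in V$. An $(\alpha,\beta')$-emulator for $G$ is a weighted graph $H'$ on $V$ (its edges need not belong to $G$) with $\mathrm{dist}_G(u,v)\le \mathrm{dist}_{H'}(u,v)\le\alpha\cdot\mathrm{dist}_G(u,v)+\beta'$ for all $u,v\in V$. -}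

module Defs where

open import Data.Empty using (⊥; ⊥-elim)
open import Data.Fin.Base as Fin using (Fin)
import Data.Fin.Properties as Fin
import Data.Integer.Base as ℤ
open import Data.List.Base using (List; []; _∷_; allFin)
open import Data.List.Membership.Propositional using (_∈_)
open import Data.List.Membership.Propositional.Properties using (∈-allFin)
open import Data.List.Relation.Unary.Any using (here; there)
open import Data.Maybe.Base as Maybe using ()
open import Data.Nat.Base as ℕ using (ℕ; zero; suc; z≤n; s≤s)
import Data.Nat.Properties as ℕ
open import Data.Product.Base using (∃; ∃-syntax; ∃₂; _×_; _,_; proj₁; proj₂)
open import Data.Rational.Base as ℚ using (ℚ; 0ℚ; ½)
import Data.Rational.Properties as ℚ
open import Data.Rational.Solver using (module +-*-Solver)
open import Data.Sum.Base using (_⊎_; inj₁; inj₂)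
open import Data.Bool.Base using (if_then_else_)
open import Level using (0ℓ)
open import Relation.Binary.Core using (Rel; _⇒_)
open import Relation.Binary.Definitions using (Decidable; Symmetric)
import Relation.Binary.Construct.Add.Supremum.NonStrict as AddSup
open import Relation.Binary.PropositionalEquality
  using (_≡_; refl; sym; trans; cong; cong₂; subst)
open import Relation.Nullary.Construct.Add.Supremum using (_⁺; [_]; ⊤⁺)
open import Relation.Nullary.Decidable.Core using (Dec; yes; no; does; _⊎-dec_)
open import Relation.Nullary.Negation.Core using (¬_)

------------------------------------------------------------------------
-- Real numbers
--
-- The standard library has none, so they are given here as Cauchy
-- sequences of rationals.  Only the additive and order structure is
-- needed: every product in sight has a natural number as one factor.

record ℝ : Set where
  field
    seq    : ℕ → ℚ
    cauchy : ∀ δ → 0ℚ ℚ.< δ →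
             ∃[ N ] ∀ i j → N ℕ.≤ i → N ℕ.≤ j → ℚ.∣ seq i ℚ.- seq j ∣ ℚ.≤ δ

open ℝ public

infix 4 _≤ℝ_ _<ℝ_

_≤ℝ_ : Rel ℝ 0ℓ
x ≤ℝ y = ∀ δ → 0ℚ ℚ.< δ → ∃[ N ] ∀ i → N ℕ.≤ i → seq x i ℚ.≤ seq y i ℚ.+ δ

_<ℝ_ : Rel ℝ 0ℓ
x <ℝ y = ∃[ δ ] 0ℚ ℚ.< δ × ∃[ N ] ∀ i → N ℕ.≤ i → seq x i ℚ.+ δ ℚ.≤ seq y i

fromℚ : ℚ → ℝ
fromℚ q = record
  { seq    = λ _ → q
  ; cauchy = λ δ 0<δ → 0 , λ _ _ _ _ →
      subst (λ r → ℚ.∣ r ∣ ℚ.≤ δ) (sym (ℚ.+-inverseʳ q)) (ℚ.<⇒≤ 0<δ)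
  }

fromℕ : ℕ → ℝ
fromℕ m = fromℚ (ℤ.+ m ℚ./ 1)

0ℝ 1ℝ : ℝ
0ℝ = fromℕ 0
1ℝ = fromℕ 1

infixl 6 _+ℝ_

_+ℝ_ : ℝ → ℝ → ℝ
x +ℝ y = record { seq = λ i → seq x i ℚ.+ seq y i ; cauchy = cauchy-+ }
  where
  open +-*-Solver using (solve; _:+_; _:-_; _:*_; _:=_; con)

  regroup : ∀ a b c d → (a ℚ.+ b) ℚ.- (c ℚ.+ d) ≡ (a ℚ.- c) ℚ.+ (b ℚ.- d)
  regroup = solve 4 (λ a b c d → (a :+ b) :- (c :+ d) := (a :- c) :+ (b :- d)) refl

  halves : ∀ δ → ½ ℚ.* δ ℚ.+ ½ ℚ.* δ ≡ δ
  halves = solve 1 (λ δ → con ½ :* δ :+ con ½ :* δ := δ) refl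

  cauchy-+ : ∀ δ → 0ℚ ℚ.< δ → ∃[ N ] ∀ i j → N ℕ.≤ i → N ℕ.≤ j →
             ℚ.∣ (seq x i ℚ.+ seq y i) ℚ.- (seq x j ℚ.+ seq y j) ∣ ℚ.≤ δ
  cauchy-+ δ 0<δ = Nx ℕ.⊔ Ny , bound
    where
    0<½δ : 0ℚ ℚ.< ½ ℚ.* δ
    0<½δ = ℚ.*-monoʳ-<-pos ½ 0<δ
    Nx = proj₁ (cauchy x (½ ℚ.* δ) 0<½δ)
    Ny = proj₁ (cauchy y (½ ℚ.* δ) 0<½δ)
    open ℚ.≤-Reasoning
    bound : ∀ i j → Nx ℕ.⊔ Ny ℕ.≤ i → Nx ℕ.⊔ Ny ℕ.≤ j →
            ℚ.∣ (seq x i ℚ.+ seq y i) ℚ.- (seq x j ℚ.+ seq y j) ∣ ℚ.≤ δ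
    bound i j N≤i N≤j = begin
      ℚ.∣ (seq x i ℚ.+ seq y i) ℚ.- (seq x j ℚ.+ seq y j) ∣
        ≡⟨ cong ℚ.∣_∣ (regroup (seq x i) (seq y i) (seq x j) (seq y j)) ⟩
      ℚ.∣ (seq x i ℚ.- seq x j) ℚ.+ (seq y i ℚ.- seq y j) ∣
        ≤⟨ ℚ.∣p+q∣≤∣p∣+∣q∣ (seq x i ℚ.- seq x j) (seq y i ℚ.- seq y j) ⟩
      ℚ.∣ seq x i ℚ.- seq x j ∣ ℚ.+ ℚ.∣ seq y i ℚ.- seq y j ∣
        ≤⟨ ℚ.+-mono-≤
             (proj₂ (cauchy x (½ ℚ.* δ) 0<½δ) i j
               (ℕ.≤-trans (ℕ.m≤m⊔n Nx Ny) N≤i) (ℕ.≤-trans (ℕ.m≤m⊔n Nx Ny) N≤j))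
             (proj₂ (cauchy y (½ ℚ.* δ) 0<½δ) i j
               (ℕ.≤-trans (ℕ.m≤n⊔m Nx Ny) N≤i) (ℕ.≤-trans (ℕ.m≤n⊔m Nx Ny) N≤j)) ⟩
      ½ ℚ.* δ ℚ.+ ½ ℚ.* δ ≡⟨ halves δ ⟩
      δ ∎

infixr 7 _·_

_·_ : ℕ → ℝ → ℝ
zero  · x = 0ℝ
suc m · x = x +ℝ m · x

------------------------------------------------------------------------
-- Values extended by ∞, the distance between disconnected vertices

ℕ∞ ℝ∞ : Set
ℕ∞ = ℕ ⁺
ℝ∞ = ℝ ⁺

open AddSup ℕ._≤_ public
  using ([_]; _≤⊤⁺) renaming (_≤⁺_ to _≤∞_)
open AddSup _≤ℝ_ public
  using () renaming (_≤⁺_ to _≤ℝ∞_; [_] to [_]ℝ; _≤⊤⁺ to _≤⊤ℝ)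

infixl 6 _+ℝ∞_
infixr 7 _·∞_

fromℕ∞ : ℕ∞ → ℝ∞
fromℕ∞ = Maybe.map fromℕ

_·∞_ : ℕ∞ → ℝ → ℝ∞
d ·∞ x = Maybe.map (_· x) d

_+ℝ∞_ : ℝ∞ → ℝ → ℝ∞
x +ℝ∞ y = Maybe.map (_+ℝ y) x

_⊓∞_ : ℕ∞ → ℕ∞ → ℕ∞
[ a ] ⊓∞ [ b ] = [ a ℕ.⊓ b ]
[ a ] ⊓∞ ⊤⁺    = [ a ]
⊤⁺    ⊓∞ e     = e

------------------------------------------------------------------------
-- Graphs on the vertex set Fin n

record Graph (n : ℕ) : Set₁ where
  field
    _~_   : Rel (Fin n) 0ℓ
    ~-sym : Symmetric _~_
    _~?_  : Decidable _~_

-- weight u v ≡ ⊤⁺ means that u and v are not joined by an edge.  All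
-- weights occurring here are distances in an unweighted graph, hence
-- natural numbers.
record WGraph (n : ℕ) : Set where
  field
    weight     : Fin n → Fin n → ℕ∞
    weight-sym : ∀ u v → weight u v ≡ weight v u

open WGraph public

unweighted : ∀ {n} → Graph n → WGraph n
unweighted G = record
  { weight     = λ u v → if does (u ~? v) then [ 1 ] else ⊤⁺
  ; weight-sym = weight-sym′
  }
  where
  open Graph G
  weight-sym′ : ∀ u v → (if does (u ~? v) then [ 1 ] else ⊤⁺)
                      ≡ (if does (v ~? u) then [ 1 ] else ⊤⁺)
  weight-sym′ u v with u ~? v | v ~? u
  ... | yes _  | yes _  = refl
  ... | no  _  | no  _  = refl
  ... | yes p  | no ¬q  = ⊥-elim (¬q (~-sym p))
  ... | no ¬p  | yes q  = ⊥-elim (¬p (~-sym q))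

infixr 6 _∪_

-- Of two parallel edges only the lighter one matters for distances.
_∪_ : ∀ {n} → WGraph n → WGraph n → WGraph n
A ∪ B = record
  { weight     = λ u v → weight A u v ⊓∞ weight B u v
  ; weight-sym = λ u v → cong₂ _⊓∞_ (weight-sym A u v) (weight-sym B u v)
  }

-- Path W k ℓ u v: a u-v path with k edges and total length ℓ.  Vertices
-- may repeat; since weights are nonnegative this changes no minimum
-- below (cutting out a cycle increases neither k nor ℓ).
data Path {n} (W : WGraph n) : ℕ → ℕ → Fin n → Fin n → Set where
  nil  : ∀ {u} → Path W 0 0 u u
  cons : ∀ {u x v w k ℓ} → weight W u x ≡ [ w ] → Path W k ℓ x v →
         Path W (suc k) (w ℕ.+ ℓ) u v

-- d is the minimum of { m | P m }, or ∞ if that set is empty.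
record IsMin (P : ℕ → Set) (d : ℕ∞) : Set where
  field
    attained : ∀ {m} → d ≡ [ m ] → P m
    minimal  : ∀ {m} → P m → d ≤∞ [ m ]

open IsMin public

HasMin : (ℕ → Set) → Set
HasMin P = ∃ (IsMin P)

PathLength : ∀ {n} → WGraph n → Fin n → Fin n → ℕ → Set
PathLength W u v ℓ = ∃[ k ] Path W k ℓ u v

PathLength≤ : ∀ {n} → ℕ → WGraph n → Fin n → Fin n → ℕ → Set
PathLength≤ β W u v ℓ = ∃[ k ] k ℕ.≤ β × Path W k ℓ u v

------------------------------------------------------------------------
-- The two minima exist

private
  ⊤≰[] : ∀ {m} {A : Set} → ⊤⁺ ≤∞ [ m ] → A
  ⊤≰[] ()

  dominated : ∀ {P Q : ℕ → Set} → (∀ {m} → Q m → P m) →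
              (∀ {m} → P m → ∃[ m′ ] m′ ℕ.≤ m × Q m′) → HasMin Q → HasMin P
  dominated Q⊆P below (d , min) = d , record
    { attained = λ eq → Q⊆P (attained min eq)
    ; minimal  = λ p → let (_ , m′≤m , q) = below p in
                       AddSup.≤⁺-trans ℕ._≤_ ℕ.≤-trans (minimal min q) [ m′≤m ]
    }

  ∅-min : HasMin (λ _ → ⊥)
  ∅-min = ⊤⁺ , record { attained = λ () ; minimal = λ () }

  dec-min : ∀ {A : Set} → Dec A → HasMin (λ m → A × m ≡ 0)
  dec-min (yes a) = [ 0 ] , record
    { attained = λ { refl → a , refl } ; minimal = λ _ → [ z≤n ] }
  dec-min (no ¬a) = ⊤⁺ , record
    { attained = λ () ; minimal = λ (a , _) → ⊥-elim (¬a a) }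

  value-min : ∀ e → HasMin (λ m → e ≡ [ m ])
  value-min e = e , record
    { attained = λ eq → eq
    ; minimal  = λ { refl → [ ℕ.≤-refl ] }
    }

  ⊎-min : ∀ {P Q : ℕ → Set} → HasMin P → HasMin Q → HasMin (λ m → P m ⊎ Q m)
  ⊎-min ([ a ] , p) ([ b ] , q) with ℕ.≤-total a b
  ... | inj₁ a≤b = [ a ] , record
    { attained = λ eq → inj₁ (attained p eq)
    ; minimal  = λ { (inj₁ x) → minimal p x
                   ; (inj₂ y) → AddSup.≤⁺-trans ℕ._≤_ ℕ.≤-trans [ a≤b ] (minimal q y) } }
  ... | inj₂ b≤a = [ b ] , record
    { attained = λ eq → inj₂ (attained q eq)
    ; minimal  = λ { (inj₁ x) → AddSup.≤⁺-trans ℕ._≤_ ℕ.≤-trans [ b≤a ] (minimal p x)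
                   ; (inj₂ y) → minimal q y } }
  ⊎-min (d , p) (⊤⁺ , q) = d , record
    { attained = λ eq → inj₁ (attained p eq)
    ; minimal  = λ { (inj₁ x) → minimal p x
                   ; (inj₂ y) → AddSup.≤⁺-trans ℕ._≤_ ℕ.≤-trans (d ≤⊤⁺) (minimal q y) } }
  ⊎-min (⊤⁺ , p) (e , q) = e , record
    { attained = λ eq → inj₂ (attained q eq)
    ; minimal  = λ { (inj₁ x) → AddSup.≤⁺-trans ℕ._≤_ ℕ.≤-trans (e ≤⊤⁺) (minimal p x)
                   ; (inj₂ y) → minimal q y } }

  +-min : ∀ {P Q : ℕ → Set} → HasMin P → HasMin Q →
          HasMin (λ m → ∃₂ λ a b → P a × Q b × m ≡ a ℕ.+ b)
  +-min ([ a ] , p) ([ b ] , q) = [ a ℕ.+ b ] , record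
    { attained = λ { refl → a , b , attained p refl , attained q refl , refl }
    ; minimal  = λ { (_ , _ , x , y , refl) →
        [ ℕ.+-mono-≤ (AddSup.[≤]-injective ℕ._≤_ (minimal p x))
                     (AddSup.[≤]-injective ℕ._≤_ (minimal q y)) ] } }
  +-min ([ a ] , p) (⊤⁺ , q) = ⊤⁺ , record
    { attained = λ ()
    ; minimal  = λ { (_ , _ , x , y , refl) → ⊤≰[] (minimal q y) } }
  +-min (⊤⁺ , p) _ = ⊤⁺ , record
    { attained = λ ()
    ; minimal  = λ { (_ , _ , x , y , refl) → ⊤≰[] (minimal p x) } }

  Fin-min : ∀ {n} {P : Fin n → ℕ → Set} → (∀ i → HasMin (P i)) →
            HasMin (λ m → ∃[ i ] P i m)
  Fin-min {zero}  mins = dominated (λ ()) (λ { (() , _) }) ∅-min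
  Fin-min {suc n} mins = dominated
    (λ { (inj₁ x) → Fin.zero , x ; (inj₂ (i , x)) → Fin.suc i , x })
    (λ { (Fin.zero , x) → _ , ℕ.≤-refl , inj₁ x
       ; (Fin.suc i , x) → _ , ℕ.≤-refl , inj₂ (i , x) })
    (⊎-min (mins Fin.zero) (Fin-min (λ i → mins (Fin.suc i))))

  module _ {n} (W : WGraph n) where

    relabel : ∀ {k a b u v} → a ≡ b → Path W k a u v → Path W k b u v
    relabel refl p = p

    _++_ : ∀ {k l a b u x v} → Path W k a u x → Path W l b x v →
           Path W (k ℕ.+ l) (a ℕ.+ b) u v
    nil ++ q = q
    cons {w = w} {ℓ = ℓ} e p ++ q =
      relabel (sym (ℕ.+-assoc w ℓ _)) (cons e (p ++ q))

    -- Paths whose intermediate vertices all lie in L.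
    data Via (L : List (Fin n)) : ℕ → Fin n → Fin n → Set where
      stop : ∀ {u} → Via L 0 u u
      edge : ∀ {u v w} → weight W u v ≡ [ w ] → Via L w u v
      via  : ∀ {u x v w ℓ} → x ∈ L → weight W u x ≡ [ w ] → Via L ℓ x v →
             Via L (w ℕ.+ ℓ) u v

    relabelVia : ∀ {L a b u v} → a ≡ b → Via L a u v → Via L b u v
    relabelVia refl p = p

    Detour : List (Fin n) → Fin n → Fin n → Fin n → ℕ → Set
    Detour L y u v m =
      ∃₂ λ a b → Via L a u y × Via L b y v × m ≡ a ℕ.+ b

    weaken : ∀ {L y ℓ u v} → Via L ℓ u v → Via (y ∷ L) ℓ u v
    weaken stop        = stop
    weaken (edge e)    = edge e
    weaken (via i e p) = via (there i) e (weaken p)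

    join : ∀ {L y a b u v} → Via L a u y → Via L b y v → Via (y ∷ L) (a ℕ.+ b) u v
    join stop     q = weaken q
    join (edge e) q = via (here refl) e (weaken q)
    join (via {w = w} {ℓ = ℓ} i e p) q =
      relabelVia (sym (ℕ.+-assoc w ℓ _)) (via (there i) e (join p q))

    split : ∀ {L y ℓ u v} → Via (y ∷ L) ℓ u v →
            ∃[ m ] m ℕ.≤ ℓ × (Via L m u v ⊎ Detour L y u v m)
    split stop     = _ , ℕ.≤-refl , inj₁ stop
    split (edge e) = _ , ℕ.≤-refl , inj₁ (edge e)
    split (via {w = w} (here refl) e p) with split p
    ... | _ , m≤ , inj₁ q = _ , ℕ.+-monoʳ-≤ w m≤ , inj₂ (_ , _ , edge e , q , refl)
    ... | _ , m≤ , inj₂ (a , b , _ , q , refl) =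
      _ , ℕ.+-monoʳ-≤ w (ℕ.≤-trans (ℕ.m≤n+m b a) m≤) ,
      inj₂ (_ , _ , edge e , q , refl)
    split (via {w = w} (there i) e p) with split p
    ... | _ , m≤ , inj₁ q = _ , ℕ.+-monoʳ-≤ w m≤ , inj₁ (via i e q)
    ... | _ , m≤ , inj₂ (a , b , q , r , refl) =
      _ , ℕ.+-monoʳ-≤ w m≤ ,
      inj₂ (_ , _ , via i e q , r , sym (ℕ.+-assoc w a b))

    via-min : ∀ L u v → HasMin (λ m → Via L m u v)
    via-min [] u v = dominated
      (λ { (inj₁ (refl , refl)) → stop ; (inj₂ e) → edge e })
      (λ { stop → _ , ℕ.≤-refl , inj₁ (refl , refl)
         ; (edge e) → _ , ℕ.≤-refl , inj₂ e
         ; (via () _ _) })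
      (⊎-min (dec-min (u Fin.≟ v)) (value-min (weight W u v)))
    via-min (y ∷ L) u v = dominated
      (λ { (inj₁ p) → weaken p ; (inj₂ (_ , _ , p , q , refl)) → join p q })
      split
      (⊎-min (via-min L u v) (+-min (via-min L u y) (via-min L y v)))

    fromVia : ∀ {L ℓ u v} → Via L ℓ u v → PathLength W u v ℓ
    fromVia stop        = _ , nil
    fromVia (edge {w = w} e) =
      _ , relabel (ℕ.+-identityʳ w) (cons e nil)
    fromVia (via _ e p) = _ , cons e (proj₂ (fromVia p))

    toVia : ∀ {k ℓ u v} → Path W k ℓ u v → Via (allFin n) ℓ u v
    toVia nil        = stop
    toVia (cons e p) = via (∈-allFin _) e (toVia p)

    path-min : ∀ u v → HasMin (PathLength W u v)
    path-min u v = dominated fromVia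
      (λ (_ , p) → _ , ℕ.≤-refl , toVia p) (via-min (allFin n) u v)

    path≤-min : ∀ β u v → HasMin (PathLength≤ β W u v)
    path≤-min zero u v = dominated
      (λ { (refl , refl) → 0 , z≤n , nil })
      (λ { (_ , z≤n , nil) → _ , ℕ.≤-refl , (refl , refl) })
      (dec-min (u Fin.≟ v))
    path≤-min (suc β) u v = dominated
      (λ { (inj₁ (refl , refl)) → 0 , z≤n , nil
         ; (inj₂ (_ , _ , _ , e , (_ , k≤β , p) , refl)) → _ , s≤s k≤β , cons e p })
      (λ { (_ , _ , nil) → _ , ℕ.≤-refl , inj₁ (refl , refl)
         ; (_ , s≤s k≤β , cons e p) →
             _ , ℕ.≤-refl , inj₂ (_ , _ , _ , e , (_ , k≤β , p) , refl) })
      (⊎-min (dec-min (u Fin.≟ v))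
             (Fin-min (λ x → +-min (value-min (weight W u x)) (path≤-min β x v))))

    reverse : ∀ {k ℓ u v} → Path W k ℓ u v → PathLength W v u ℓ
    reverse nil = _ , nil
    reverse (cons {w = w} {ℓ = ℓ} e p) =
      _ , relabel
            (trans (cong (ℓ ℕ.+_) (ℕ.+-identityʳ w)) (ℕ.+-comm ℓ w))
            (proj₂ (reverse p) ++ cons (trans (weight-sym W _ _) e) nil)

  min-mono : ∀ {P Q : ℕ → Set} {d e} → (∀ {m} → Q m → P m) →
             IsMin P d → IsMin Q e → d ≤∞ e
  min-mono {e = [ _ ]} Q⊆P p q = minimal p (Q⊆P (attained q refl))
  min-mono {e = ⊤⁺}    Q⊆P p q = _ ≤⊤⁺

------------------------------------------------------------------------
-- Distances

dist : ∀ {n} → WGraph n → Fin n → Fin n → ℕ∞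
dist W u v = proj₁ (path-min W u v)

dist-isMin : ∀ {n} (W : WGraph n) u v → IsMin (PathLength W u v) (dist W u v)
dist-isMin W u v = proj₂ (path-min W u v)

-- dist≤ β W is the distance over paths with at most β edges.
dist≤ : ∀ {n} → ℕ → WGraph n → Fin n → Fin n → ℕ∞
dist≤ β W u v = proj₁ (path≤-min W β u v)

dist≤-isMin : ∀ {n} β (W : WGraph n) u v →
              IsMin (PathLength≤ β W u v) (dist≤ β W u v)
dist≤-isMin β W u v = proj₂ (path≤-min W β u v)

dist-sym : ∀ {n} (W : WGraph n) u v → dist W u v ≡ dist W v u
dist-sym W u v = AddSup.≤⁺-antisym-≡ ℕ._≤_ ℕ.≤-antisym
  (min-mono (λ (_ , p) → reverse W p) (dist-isMin W u v) (dist-isMin W v u))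
  (min-mono (λ (_ , p) → reverse W p) (dist-isMin W v u) (dist-isMin W u v))

dist[_] : ∀ {n} → Graph n → Fin n → Fin n → ℕ∞
dist[ G ] = dist (unweighted G)

------------------------------------------------------------------------
-- Hopsets, spanners, emulators

-- H ⊆ V × V as an undirected graph, each edge weighted by the distance
-- in G of its endpoints.  A pair at infinite distance yields no edge.
weightedBy : ∀ {n} (G : Graph n) {H : Rel (Fin n) 0ℓ} → Decidable H → WGraph n
weightedBy {n} G {H} H? = record
  { weight     = λ u v → if does (H? u v ⊎-dec H? v u) then dist[ G ] u v else ⊤⁺
  ; weight-sym = weight-sym′
  }
  where
  weight-sym′ : ∀ u v →
    (if does (H? u v ⊎-dec H? v u) then dist[ G ] u v else ⊤⁺) ≡
    (if does (H? v u ⊎-dec H? u v) then dist[ G ] v u else ⊤⁺)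
  weight-sym′ u v with H? u v | H? v u
  ... | yes _ | yes _ = dist-sym (unweighted G) u v
  ... | yes _ | no  _ = dist-sym (unweighted G) u v
  ... | no  _ | yes _ = dist-sym (unweighted G) u v
  ... | no  _ | no  _ = refl

record IsHopset {n} (β : ℕ) (ε : ℝ) (G : Graph n)
                {H : Rel (Fin n) 0ℓ} (H? : Decidable H) : Set where
  field
    lower : ∀ u v →
      dist[ G ] u v ≤∞ dist≤ β (unweighted G ∪ weightedBy G H?) u v
    upper : ∀ u v →
      fromℕ∞ (dist≤ β (unweighted G ∪ weightedBy G H?) u v)
        ≤ℝ∞ dist[ G ] u v ·∞ (1ℝ +ℝ ε)

record IsSpanner {n} (t : ℝ) (G G* : Graph n) : Set where
  field
    subgraph : Graph._~_ G* ⇒ Graph._~_ G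
    stretch  : ∀ u v → fromℕ∞ (dist[ G* ] u v) ≤ℝ∞ dist[ G ] u v ·∞ t

record IsEmulator {n} (α β′ : ℝ) (G : Graph n) (H′ : WGraph n) : Set where
  field
    lower : ∀ u v → dist[ G ] u v ≤∞ dist H′ u v
    upper : ∀ u v →
      fromℕ∞ (dist H′ u v) ≤ℝ∞ dist[ G ] u v ·∞ α +ℝ∞ β′

-- Replace every edge of G on an optimal hopset path with at most β edges
-- by a shortest path in G*.  The new length of such an edge is at most t,
-- and an edge of H* is kept, so the replacement costs an additive error
-- of at most t per edge and hence of at most β t in total.

{-# OPTIONS --safe #-}
module Submission where

open import Defs
open import Data.Bool.Base using (true; false)
open import Data.Fin.Base using (Fin)
import Data.Integer.Base as ℤ
import Data.Integer.Properties as ℤ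
open import Data.Nat.Base using (ℕ; zero; suc; z≤n; s≤s; _≤_; _+_; _⊔_)
import Data.Nat.Properties as ℕ
open import Data.Product.Base using (_,_; proj₁; proj₂)
open import Data.Rational.Base as ℚ using (0ℚ; ½)
import Data.Rational.Properties as ℚ
open import Data.Rational.Solver using (module +-*-Solver)
import Data.Rational.Unnormalised.Base as ℚᵘ
import Data.Rational.Unnormalised.Properties as ℚᵘ
open import Data.Sum.Base as Sum using (_⊎_; inj₁; inj₂)
open import Level using (0ℓ)
open import Relation.Binary.Core using (Rel)
open import Relation.Binary.Definitions using (Decidable)
import Relation.Binary.Construct.Add.Supremum.NonStrict as AddSup
open import Relation.Binary.PropositionalEquality
  using (_≡_; refl; sym; trans; cong; cong₂; subst)
import Relation.Binary.Reasoning.Base.Single as Reasoning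
open import Relation.Nullary.Construct.Add.Supremum using ([_]; ⊤⁺)
open import Relation.Nullary.Decidable.Core using (yes; no; does; _⊎-dec_)
open import Relation.Nullary.Negation.Core using (contradiction)

-- Real numbers

halves : ∀ p δ → (p ℚ.+ ½ ℚ.* δ) ℚ.+ ½ ℚ.* δ ≡ p ℚ.+ δ
halves = solve 2 (λ p δ → (p :+ con ½ :* δ) :+ con ½ :* δ := p :+ δ) refl
  where open +-*-Solver

+-interchange : ∀ a b c d → (a ℚ.+ b) ℚ.+ (c ℚ.+ d) ≡ (a ℚ.+ c) ℚ.+ (b ℚ.+ d)
+-interchange = solve 4 (λ a b c d → (a :+ b) :+ (c :+ d) := (a :+ c) :+ (b :+ d)) refl
  where open +-*-Solver

0<½* : ∀ {δ} → 0ℚ ℚ.< δ → 0ℚ ℚ.< ½ ℚ.* δ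
0<½* = ℚ.*-monoʳ-<-pos ½

pointwise⇒≤ℝ : ∀ {x y} → (∀ i → seq x i ℚ.≤ seq y i) → x ≤ℝ y
pointwise⇒≤ℝ {x} {y} x≤y δ 0<δ = 0 , λ i _ →
  subst (ℚ._≤ seq y i ℚ.+ δ) (ℚ.+-identityʳ (seq x i))
    (ℚ.+-mono-≤ (x≤y i) (ℚ.<⇒≤ 0<δ))

≤ℝ-refl : ∀ {x} → x ≤ℝ x
≤ℝ-refl {x} = pointwise⇒≤ℝ {x} {x} (λ _ → ℚ.≤-refl)

≤ℝ-trans : ∀ {x y z} → x ≤ℝ y → y ≤ℝ z → x ≤ℝ z
≤ℝ-trans {x} {y} {z} x≤y y≤z δ 0<δ
  -- Each hypothesis receives half of the tolerance `δ`; beyond the larger of the two indices both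
  -- estimates apply.
  with x≤y (½ ℚ.* δ) (0<½* 0<δ) | y≤z (½ ℚ.* δ) (0<½* 0<δ)
... | M , x≤y+ | N , y≤z+ = M ⊔ N , λ i M⊔N≤i → begin
  seq x i
    ≤⟨ x≤y+ i (ℕ.≤-trans (ℕ.m≤m⊔n M N) M⊔N≤i) ⟩
  seq y i ℚ.+ ½ ℚ.* δ
    ≤⟨ ℚ.+-monoˡ-≤ (½ ℚ.* δ) (y≤z+ i (ℕ.≤-trans (ℕ.m≤n⊔m M N) M⊔N≤i)) ⟩
  (seq z i ℚ.+ ½ ℚ.* δ) ℚ.+ ½ ℚ.* δ
    ≡⟨ halves (seq z i) δ ⟩
  seq z i ℚ.+ δ ∎
  where open ℚ.≤-Reasoning

+ℝ-mono-≤ : ∀ {x y z w} → x ≤ℝ y → z ≤ℝ w → x +ℝ z ≤ℝ y +ℝ w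
+ℝ-mono-≤ {x} {y} {z} {w} x≤y z≤w δ 0<δ
  with x≤y (½ ℚ.* δ) (0<½* 0<δ) | z≤w (½ ℚ.* δ) (0<½* 0<δ)
... | M , x≤y+ | N , z≤w+ = M ⊔ N , λ i M⊔N≤i → begin
  seq x i ℚ.+ seq z i
    ≤⟨ ℚ.+-mono-≤ (x≤y+ i (ℕ.≤-trans (ℕ.m≤m⊔n M N) M⊔N≤i))
                  (z≤w+ i (ℕ.≤-trans (ℕ.m≤n⊔m M N) M⊔N≤i)) ⟩
  (seq y i ℚ.+ ½ ℚ.* δ) ℚ.+ (seq w i ℚ.+ ½ ℚ.* δ)
    ≡⟨ +-interchange (seq y i) (½ ℚ.* δ) (seq w i) (½ ℚ.* δ) ⟩
  (seq y i ℚ.+ seq w i) ℚ.+ (½ ℚ.* δ ℚ.+ ½ ℚ.* δ)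
    ≡⟨ ℚ.+-assoc (seq y i ℚ.+ seq w i) (½ ℚ.* δ) (½ ℚ.* δ) ⟨
  ((seq y i ℚ.+ seq w i) ℚ.+ ½ ℚ.* δ) ℚ.+ ½ ℚ.* δ
    ≡⟨ halves (seq y i ℚ.+ seq w i) δ ⟩
  (seq y i ℚ.+ seq w i) ℚ.+ δ ∎
  where open ℚ.≤-Reasoning

-- `_≤ℝ_` unfolds to a statement about `seq` alone, from which the records cannot be recovered by
-- unification; hence the explicit implicit arguments here and below.
module ≤ℝ-Reasoning = Reasoning _≤ℝ_
  (λ {x} → ≤ℝ-refl {x}) (λ {x y z} → ≤ℝ-trans {x} {y} {z})

-- The two reals carry different `cauchy` proofs, so algebraic identities are stated as inequalities
-- in the direction used.
+ℝ-interchange : ∀ a b c d → (a +ℝ b) +ℝ (c +ℝ d) ≤ℝ (a +ℝ c) +ℝ (b +ℝ d)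
+ℝ-interchange a b c d =
  pointwise⇒≤ℝ {(a +ℝ b) +ℝ (c +ℝ d)} {(a +ℝ c) +ℝ (b +ℝ d)}
    (λ i → ℚ.≤-reflexive (+-interchange (seq a i) (seq b i) (seq c i) (seq d i)))

≤ℝ-+ʳ : ∀ x {y} → 0ℝ ≤ℝ y → x ≤ℝ x +ℝ y
≤ℝ-+ʳ x {y} 0≤y = begin
  x         ∼⟨ pointwise⇒≤ℝ {x} {x +ℝ 0ℝ}
                 (λ i → ℚ.≤-reflexive (sym (ℚ.+-identityʳ (seq x i)))) ⟩
  x +ℝ 0ℝ   ∼⟨ +ℝ-mono-≤ {x} {x} {0ℝ} {y} (≤ℝ-refl {x}) 0≤y ⟩
  x +ℝ y    ∎
  where open ≤ℝ-Reasoning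

≤ℝ-+ˡ : ∀ x {y} → 0ℝ ≤ℝ y → x ≤ℝ y +ℝ x
≤ℝ-+ˡ x {y} 0≤y = begin
  x         ∼⟨ ≤ℝ-+ʳ x {y} 0≤y ⟩
  x +ℝ y    ∼⟨ pointwise⇒≤ℝ {x +ℝ y} {y +ℝ x}
                 (λ i → ℚ.≤-reflexive (ℚ.+-comm (seq x i) (seq y i))) ⟩
  y +ℝ x    ∎
  where open ≤ℝ-Reasoning

0≤· : ∀ k {x} → 0ℝ ≤ℝ x → 0ℝ ≤ℝ k · x
0≤· zero        0≤x = ≤ℝ-refl {0ℝ}
0≤· (suc k) {x} 0≤x =
  ≤ℝ-trans {0ℝ} {x} {suc k · x} 0≤x (≤ℝ-+ʳ x {k · x} (0≤· k {x} 0≤x))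

·-monoˡ-≤ : ∀ {k l} x → 0ℝ ≤ℝ x → k ≤ l → k · x ≤ℝ l · x
·-monoˡ-≤ {l = l} x 0≤x z≤n = 0≤· l {x} 0≤x
·-monoˡ-≤ {suc k} {suc l} x 0≤x (s≤s k≤l) =
  +ℝ-mono-≤ {x} {x} {k · x} {l · x} (≤ℝ-refl {x}) (·-monoˡ-≤ x 0≤x k≤l)

-- `ℚ._/_` reduces fractions by a gcd that is stuck on variables. Among unnormalised rationals all
-- denominators are 1 and cross-multiplication leaves an integer identity.
/1-homo-+ : ∀ a b → ℤ.+ (a + b) ℚ./ 1 ≡ ℤ.+ a ℚ./ 1 ℚ.+ ℤ.+ b ℚ./ 1
/1-homo-+ a b = ℚ.toℚᵘ-injective (begin-equality
  ℚ.toℚᵘ (ℤ.+ (a + b) ℚ./ 1)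
    ≃⟨ ℚ.toℚᵘ-fromℚᵘ (ι (a + b)) ⟩
  ι (a + b)
    ≃⟨ ℚᵘ.*≡* (cong (ℤ._* ℤ.+ 1) (sym (cong₂ ℤ._+_ (ℤ.*-identityʳ (ℤ.+ a)) (ℤ.*-identityʳ (ℤ.+ b))))) ⟩
  ι a ℚᵘ.+ ι b
    ≃⟨ ℚᵘ.+-cong (ℚ.toℚᵘ-fromℚᵘ (ι a)) (ℚ.toℚᵘ-fromℚᵘ (ι b)) ⟨
  ℚ.toℚᵘ (ℤ.+ a ℚ./ 1) ℚᵘ.+ ℚ.toℚᵘ (ℤ.+ b ℚ./ 1)
    ≃⟨ ℚ.toℚᵘ-homo-+ (ℤ.+ a ℚ./ 1) (ℤ.+ b ℚ./ 1) ⟨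
  ℚ.toℚᵘ (ℤ.+ a ℚ./ 1 ℚ.+ ℤ.+ b ℚ./ 1) ∎)
  where
  open ℚᵘ.≤-Reasoning
  ι : ℕ → ℚᵘ.ℚᵘ
  ι m = ℚᵘ.mkℚᵘ (ℤ.+ m) 0

/1-mono-≤ : ∀ {a b} → a ≤ b → ℤ.+ a ℚ./ 1 ℚ.≤ ℤ.+ b ℚ./ 1
/1-mono-≤ {a} {b} a≤b = ℚ.toℚᵘ-cancel-≤ (begin
  ℚ.toℚᵘ (ℤ.+ a ℚ./ 1)  ≃⟨ ℚ.toℚᵘ-fromℚᵘ (ℚᵘ.mkℚᵘ (ℤ.+ a) 0) ⟩
  ℚᵘ.mkℚᵘ (ℤ.+ a) 0     ≤⟨ ℚᵘ.*≤* (ℤ.*-monoʳ-≤-nonNeg (ℤ.+ 1) (ℤ.+≤+ a≤b)) ⟩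
  ℚᵘ.mkℚᵘ (ℤ.+ b) 0     ≃⟨ ℚ.toℚᵘ-fromℚᵘ (ℚᵘ.mkℚᵘ (ℤ.+ b) 0) ⟨
  ℚ.toℚᵘ (ℤ.+ b ℚ./ 1)  ∎)
  where open ℚᵘ.≤-Reasoning

fromℕ-mono-≤ : ∀ {a b} → a ≤ b → fromℕ a ≤ℝ fromℕ b
fromℕ-mono-≤ {a} {b} a≤b = pointwise⇒≤ℝ {fromℕ a} {fromℕ b} (λ _ → /1-mono-≤ a≤b)

fromℕ-+-≤ : ∀ a b → fromℕ (a + b) ≤ℝ fromℕ a +ℝ fromℕ b
fromℕ-+-≤ a b = pointwise⇒≤ℝ {fromℕ (a + b)} {fromℕ a +ℝ fromℕ b}
  (λ _ → ℚ.≤-reflexive (/1-homo-+ a b))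

fromℕ-+-≥ : ∀ a b → fromℕ a +ℝ fromℕ b ≤ℝ fromℕ (a + b)
fromℕ-+-≥ a b = pointwise⇒≤ℝ {fromℕ a +ℝ fromℕ b} {fromℕ (a + b)}
  (λ _ → ℚ.≤-reflexive (sym (/1-homo-+ a b)))

-- Extended values

≤∞-refl : ∀ {d} → d ≤∞ d
≤∞-refl = AddSup.≤⁺-reflexive-≡ _≤_ ℕ.≤-reflexive refl

≤∞-trans : ∀ {d e f} → d ≤∞ e → e ≤∞ f → d ≤∞ f
≤∞-trans = AddSup.≤⁺-trans _≤_ ℕ.≤-trans

≤ℝ∞-trans : ∀ {x y z} → x ≤ℝ∞ y → y ≤ℝ∞ z → x ≤ℝ∞ z
≤ℝ∞-trans = AddSup.≤⁺-trans _≤ℝ_ (λ {x y z} → ≤ℝ-trans {x} {y} {z})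

fromℕ∞-mono-≤ : ∀ {d e} → d ≤∞ e → fromℕ∞ d ≤ℝ∞ fromℕ∞ e
fromℕ∞-mono-≤ [ a≤b ]   = [ fromℕ-mono-≤ a≤b ]ℝ
fromℕ∞-mono-≤ (_ ≤⊤⁺) = _ ≤⊤ℝ

·∞-monoˡ-≤ : ∀ {d e} x → 0ℝ ≤ℝ x → d ≤∞ e → d ·∞ x ≤ℝ∞ e ·∞ x
·∞-monoˡ-≤ x 0≤x [ a≤b ]   = [ ·-monoˡ-≤ x 0≤x a≤b ]ℝ
·∞-monoˡ-≤ x 0≤x (_ ≤⊤⁺) = _ ≤⊤ℝ

⊓∞-lowerˡ : ∀ d e → (d ⊓∞ e) ≤∞ d
⊓∞-lowerˡ [ a ] [ b ] = [ ℕ.m⊓n≤m a b ]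
⊓∞-lowerˡ [ a ] ⊤⁺    = ≤∞-refl
⊓∞-lowerˡ ⊤⁺    e     = e ≤⊤⁺

⊓∞-lowerʳ : ∀ d e → (d ⊓∞ e) ≤∞ e
⊓∞-lowerʳ [ a ] [ b ] = [ ℕ.m⊓n≤n a b ]
⊓∞-lowerʳ [ a ] ⊤⁺    = [ a ] ≤⊤⁺
⊓∞-lowerʳ ⊤⁺    e     = ≤∞-refl

⊓∞-sel : ∀ d e → (d ⊓∞ e ≡ d) ⊎ (d ⊓∞ e ≡ e)
⊓∞-sel [ a ] [ b ] with ℕ.⊓-sel a b
... | inj₁ eq = inj₁ (cong [_] eq)
... | inj₂ eq = inj₂ (cong [_] eq)
⊓∞-sel [ a ] ⊤⁺    = inj₁ refl
⊓∞-sel ⊤⁺    e     = inj₂ refl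

⊓∞-greatest : ∀ {d e f} → f ≤∞ d → f ≤∞ e → f ≤∞ (d ⊓∞ e)
⊓∞-greatest {d} {e} {f} f≤d f≤e with ⊓∞-sel d e
... | inj₁ eq = subst (f ≤∞_) (sym eq) f≤d
... | inj₂ eq = subst (f ≤∞_) (sym eq) f≤e

-- Distances

module _ {n} {W : WGraph n} where

  infixr 5 _++_

  _++_ : ∀ {k l a b u x v} → Path W k a u x → Path W l b x v →
         Path W (k + l) (a + b) u v
  nil ++ q = q
  _++_ {l = l} {b = b} {u} {v = v} (cons {w = w} {k = k} {ℓ = ℓ} e p) q =
    subst (λ m → Path W (suc k + l) m u v) (sym (ℕ.+-assoc w ℓ b)) (cons e (p ++ q))

module _ {n} (W : WGraph n) where

  dist-refl : ∀ u → dist W u u ≤∞ [ 0 ]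
  dist-refl u = minimal (dist-isMin W u u) (_ , nil)

  dist≤weight : ∀ u v → dist W u v ≤∞ weight W u v
  dist≤weight u v with weight W u v in eq
  ... | ⊤⁺    = _ ≤⊤⁺
  ... | [ w ] = subst (λ m → dist W u v ≤∞ [ m ]) (ℕ.+-identityʳ w)
                  (minimal (dist-isMin W u v) (_ , cons eq nil))

  dist-triangle : ∀ {u x v a b} → dist W u x ≡ [ a ] → dist W x v ≡ [ b ] →
                  dist W u v ≤∞ [ a + b ]
  dist-triangle {u} {x} {v} eq₁ eq₂ = minimal (dist-isMin W u v)
    (_ , proj₂ (attained (dist-isMin W u x) eq₁) ++ proj₂ (attained (dist-isMin W x v) eq₂))

  dist-triangle-≤ : ∀ {u x v a b} → dist W u x ≤∞ [ a ] → dist W x v ≤∞ [ b ] →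
                    dist W u v ≤∞ [ a + b ]
  dist-triangle-≤ {u} {x} {v} p q with dist W u x in eq₁ | dist W x v in eq₂ | p | q
  ... | [ _ ] | [ _ ] | [ c≤a ] | [ d≤b ] =
    ≤∞-trans (dist-triangle eq₁ eq₂) [ ℕ.+-mono-≤ c≤a d≤b ]

  -- Bounds must be real here because the stretch `t` need not be an integer.
  dist-triangle-≤ℝ : ∀ {u x v a b} → fromℕ∞ (dist W u x) ≤ℝ∞ [ a ] →
                     fromℕ∞ (dist W x v) ≤ℝ∞ [ b ] →
                     fromℕ∞ (dist W u v) ≤ℝ∞ [ a +ℝ b ]
  dist-triangle-≤ℝ {u} {x} {v} {a} {b} p q
    with dist W u x in eq₁ | dist W x v in eq₂ | p | q
  ... | [ c ] | [ d ] | [ c≤a ]ℝ | [ d≤b ]ℝ =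
    ≤ℝ∞-trans (fromℕ∞-mono-≤ (dist-triangle eq₁ eq₂))
      [ ≤ℝ-trans {fromℕ (c + d)} {fromℕ c +ℝ fromℕ d} {a +ℝ b} (fromℕ-+-≤ c d)
          (+ℝ-mono-≤ {fromℕ c} {a} {fromℕ d} {b} c≤a d≤b) ]ℝ

-- Comparing distances in two weighted graphs

module _ {n} {A B : WGraph n} where

  -- A shortest path in `A` is followed edge by edge, with the triangle inequality in `B` applied at
  -- each step.
  dist-dominated : (∀ u v → dist B u v ≤∞ weight A u v) →
                   ∀ u v → dist B u v ≤∞ dist A u v
  dist-dominated dist≤weightA u v with dist A u v in eq
  ... | ⊤⁺    = _ ≤⊤⁺
  ... | [ _ ] = along (proj₂ (attained (dist-isMin A u v) eq))
    where
    along : ∀ {k ℓ u v} → Path A k ℓ u v → dist B u v ≤∞ [ ℓ ]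
    along nil = dist-refl B _
    along (cons {u = u} {x = x} e p) = dist-triangle-≤ B
      (subst (dist B u x ≤∞_) e (dist≤weightA u x)) (along p)

  -- By induction along the path, the triangle inequality in `B` adds up the edge bounds: the
  -- weights sum to `ℓ`, and each of the `k` edges contributes one `t`.
  path-stretch : ∀ {t} →
    (∀ {u v w} → weight A u v ≡ [ w ] → fromℕ∞ (dist B u v) ≤ℝ∞ [ fromℕ w +ℝ t ]) →
    ∀ {k ℓ u v} → Path A k ℓ u v → fromℕ∞ (dist B u v) ≤ℝ∞ [ fromℕ ℓ +ℝ k · t ]
  path-stretch {t} edge nil = ≤ℝ∞-trans (fromℕ∞-mono-≤ (dist-refl B _))
    -- On the empty path the bound computes to `0ℝ +ℝ 0ℝ`.
    [ ≤ℝ-+ʳ 0ℝ {0ℝ} (≤ℝ-refl {0ℝ}) ]ℝ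
  path-stretch {t} edge (cons {w = w} {k = k} {ℓ = ℓ} e p) = ≤ℝ∞-trans
    (dist-triangle-≤ℝ B (edge e) (path-stretch {t} edge p))
    [ (begin
      (fromℕ w +ℝ t) +ℝ (fromℕ ℓ +ℝ k · t)
        ∼⟨ +ℝ-interchange (fromℕ w) t (fromℕ ℓ) (k · t) ⟩
      (fromℕ w +ℝ fromℕ ℓ) +ℝ suc k · t
        ∼⟨ +ℝ-mono-≤ {fromℕ w +ℝ fromℕ ℓ} {fromℕ (w + ℓ)} {suc k · t} {suc k · t}
             (fromℕ-+-≥ w ℓ) (≤ℝ-refl {suc k · t}) ⟩
      fromℕ (w + ℓ) +ℝ suc k · t ∎) ]ℝ
    where open ≤ℝ-Reasoning

  -- The estimate is applied to a path attaining the hop-bounded minimum. It has `k ≤ β` edges, and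
  -- `0 ≤ t` turns the error `k · t` into `β · t`. In the application `x` is the hopset's upper
  -- bound.
  path≤-stretch : ∀ {t} → 0ℝ ≤ℝ t →
    (∀ {u v w} → weight A u v ≡ [ w ] → fromℕ∞ (dist B u v) ≤ℝ∞ [ fromℕ w +ℝ t ]) →
    ∀ {β u v d x} → IsMin (PathLength≤ β A u v) d → fromℕ∞ d ≤ℝ∞ x →
    fromℕ∞ (dist B u v) ≤ℝ∞ x +ℝ∞ β · t
  path≤-stretch     0≤t edge {x = ⊤⁺} min d≤x = _ ≤⊤ℝ
  path≤-stretch {t} 0≤t edge {β} {d = [ ℓ ]} {[ x ]} min [ ℓ≤x ]ℝ =
    let k , k≤β , p = attained min refl in ≤ℝ∞-trans (path-stretch {t} edge p)
      [ +ℝ-mono-≤ {fromℕ ℓ} {x} {k · t} {β · t} ℓ≤x (·-monoˡ-≤ t 0≤t k≤β) ]ℝ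

-- Unions of weighted graphs

module _ {n} (A B : WGraph n) where

  -- A minimum equals one of its arguments. This permits treating the edges of a hopset path by
  -- origin.
  ∪-edge : ∀ {u v w} → weight (A ∪ B) u v ≡ [ w ] →
           (weight A u v ≡ [ w ]) ⊎ (weight B u v ≡ [ w ])
  ∪-edge {u} {v} e = Sum.map (λ eq → trans (sym eq) e) (λ eq → trans (sym eq) e)
    (⊓∞-sel (weight A u v) (weight B u v))

  dist-∪ˡ : ∀ u v → dist (A ∪ B) u v ≤∞ dist A u v
  dist-∪ˡ = dist-dominated λ u v →
    ≤∞-trans (dist≤weight (A ∪ B) u v) (⊓∞-lowerˡ (weight A u v) (weight B u v))

  dist-∪ʳ : ∀ u v → dist (A ∪ B) u v ≤∞ dist B u v
  dist-∪ʳ = dist-dominated λ u v →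
    ≤∞-trans (dist≤weight (A ∪ B) u v) (⊓∞-lowerʳ (weight A u v) (weight B u v))

-- Edges of the graph, the spanner and the hopset

unweighted≡1 : ∀ {n} (G : Graph n) {u v w} → weight (unweighted G) u v ≡ [ w ] → w ≡ 1
unweighted≡1 G {u} {v} eq with Graph._~?_ G u v
unweighted≡1 G refl | yes _ = refl

-- An edge of `G*` is also an edge of `G`, hence a path of length 1 there. `dist-dominated` passes
-- from edges to paths.
dist-subgraph : ∀ {n} (G G* : Graph n) → (∀ {u v} → Graph._~_ G* u v → Graph._~_ G u v) →
                ∀ u v → dist[ G ] u v ≤∞ weight (unweighted G*) u v
dist-subgraph G G* sub u v with Graph._~?_ G* u v
... | no  _   = _ ≤⊤⁺
-- Abstracting the decision together with `dist≤weight` makes the latter's bound reduce to `[ 1 ]`.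
... | yes u~v with Graph._~?_ G u v | dist≤weight (unweighted G) u v
...   | yes _   | d≤1 = d≤1
...   | no  u≁v | _   = contradiction (sub u~v) u≁v

dist≤weightedBy : ∀ {n} (G : Graph n) {H : Rel (Fin n) 0ℓ} (H? : Decidable H) →
                  ∀ u v → dist[ G ] u v ≤∞ weight (weightedBy G H?) u v
dist≤weightedBy G H? u v with does (H? u v ⊎-dec H? v u)
... | true  = ≤∞-refl
... | false = _ ≤⊤⁺

module _ {n} {t : ℝ} {G G* : Graph n} (0≤t : 0ℝ ≤ℝ t) (S : IsSpanner t G G*) where

  -- The spanner stretches an edge of length 1 to at most `t`; the bound is relaxed to `1 + t` so
  -- that it has the same form as for hopset edges.
  spanner-edge : ∀ {u v w} → weight (unweighted G) u v ≡ [ w ] →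
                 fromℕ∞ (dist[ G* ] u v) ≤ℝ∞ [ fromℕ w +ℝ t ]
  spanner-edge {u} {v} e with unweighted≡1 G e
  ... | refl = ≤ℝ∞-trans (IsSpanner.stretch S u v) (≤ℝ∞-trans
    -- The distance in `G` is only known to be at most 1, since an edge may be a loop; nonnegativity
    -- of `t` covers this.
    (·∞-monoˡ-≤ t 0≤t (subst (dist[ G ] u v ≤∞_) e (dist≤weight (unweighted G) u v)))
    [ (begin
      -- `1 · t` unfolds to this sum.
      t +ℝ 0ℝ  ∼⟨ pointwise⇒≤ℝ {t +ℝ 0ℝ} {t} (λ i → ℚ.≤-reflexive (ℚ.+-identityʳ (seq t i))) ⟩
      t        ∼⟨ ≤ℝ-+ˡ t {1ℝ} (fromℕ-mono-≤ {0} {1} z≤n) ⟩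
      1ℝ +ℝ t  ∎) ]ℝ)
    where open ≤ℝ-Reasoning

mainTheorem4 : (n : ℕ) (G : Graph n) (β : ℕ) (ε t : ℝ) →
    1 ≤ β → 0ℝ <ℝ ε → ε <ℝ 1ℝ → 0ℝ ≤ℝ t →
    (H* : Rel (Fin n) 0ℓ) (H*? : Decidable H*) → IsHopset β ε G H*? →
    (G* : Graph n) → IsSpanner t G G* →
    IsEmulator (1ℝ +ℝ ε) (β · t) G (weightedBy G H*? ∪ unweighted G*)
mainTheorem4 n G β ε t _ _ _ 0≤t H* H*? hopset G* spanner = record
  -- Every edge of the emulator weighs at least the distance in `G` between its endpoints, so no
  -- path in it is shorter than that distance.
  { lower = dist-dominated λ u v → ⊓∞-greatest
      (dist≤weightedBy G H*? u v)
      (dist-subgraph G G* (IsSpanner.subgraph spanner) u v)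
  -- The path being followed lies in `unweighted G ∪ H′`, while the distances being bounded are
  -- those of `K`.
  ; upper = λ u v → path≤-stretch {A = unweighted G ∪ H′} {B = K} {t} 0≤t
      (λ e → edge (∪-edge (unweighted G) H′ e)) {β}
      (dist≤-isMin β (unweighted G ∪ H′) u v) (IsHopset.upper hopset u v)
  }
  where
  H′ = weightedBy G H*?
  K  = H′ ∪ unweighted G*

  edge : ∀ {u v w} → (weight (unweighted G) u v ≡ [ w ]) ⊎ (weight H′ u v ≡ [ w ]) →
         fromℕ∞ (dist K u v) ≤ℝ∞ [ fromℕ w +ℝ t ]
  edge {u} {v} (inj₁ e) = ≤ℝ∞-trans
    (fromℕ∞-mono-≤ (dist-∪ʳ H′ (unweighted G*) u v))
    (spanner-edge {t = t} 0≤t spanner e)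
  edge {u} {v} {w} (inj₂ e) = ≤ℝ∞-trans
    (fromℕ∞-mono-≤ (≤∞-trans (dist-∪ˡ H′ (unweighted G*) u v)
      (subst (dist H′ u v ≤∞_) e (dist≤weight H′ u v))))
    -- A hopset edge incurs no error; `0 ≤ t` pads its bound to the common form.
    [ ≤ℝ-+ʳ (fromℕ w) {t} 0≤t ]ℝ
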